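{- Let $R$ be a principal ideal domain with field of fractions $K$, let $1\le k\le n$, and let $\psi:\mathcal{A}_{k,n}\to K$ be a specialization of $\mathcal{A}_{k,n}$ such that $\psi(t_{i_1,\ldots,i_k})\in R\setminus\{0\}$ for all $1\le i_1<\cdots<i_k\le n$. Then $\psi$ has a representation $X\in R^{k\times n}$, i.e. there is a matrix $X\in R^{k\times n}$ such that for all $1\le i_1<\cdots<i_k\le n$, the determinant of the $k\times k$ submatrix of $X$ formed by the columns $i_1,\ldots,i_k$ equals $\psi(t_{i_1,\ldots,i_k})$.
   Context: Let $K$ be a field. Let $P=K[x_{i,j}\mid 1\le i\le k,\ 1\le j\le n]$ be the polynomial ring in the entries of a generic $k\times n$ matrix $X$, and $T=K[t_{i_1,\ldots,i_k}\mid 1\le i_1<\cdots<i_k\le n]$. Let $p:T\to P$ be the $K$-algebra homomorphism sending $t_{i_1,\ldots,i_k}$ to the determinant of the submatrix of $X$ formed by columns $i_1,\ldots,i_k$. Then $\mathcal{A}_{k,n}:=T/\ker(p)$ (the homogeneous coordinate ring of the Grassmannian $\mathrm{Gr}(k,n)$), and $t_{i_1,\ldots,i_k}$ also denotes its image in $\mathcal{A}_{k,n}$. A specialization of $\mathcal{A}_{k,n}$ is a $K$-algebra homomorphism $\psi:\mathcal{A}_{k,n}\to K$ (equivalently, an assignment of values in $K$ to the $t_{i_1,\ldots,i_k}$ satisfying every polynomial relation holding among the maximal minors of a generic $k\times n$ matrix). -}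

module Defs where

open import Level using (Level; _⊔_)
open import Data.Nat using (ℕ; zero; suc)
open import Data.Fin using (Fin; zero; suc; punchIn; _<_)
open import Data.Product using (Σ; _×_; _,_; ∃; proj₁; proj₂)
open import Data.Sum using (_⊎_; inj₁; inj₂)
open import Relation.Nullary using (¬_)
open import Algebra.Bundles using (CommutativeRing)

module DetOps {a} {A : Set a} (_+_ _*_ : A → A → A) (-_ : A → A) (0# 1# : A) where
  altSum : ∀ {m} → (Fin m → A) → A
  altSum {zero} f = 0#
  altSum {suc m} f = f zero + (- altSum (λ i → f (suc i)))

  det : ∀ {m} → (Fin m → Fin m → A) → A
  det {zero} M = 1#
  det {suc m} M = altSum (λ j → M zero j * det (λ i l → M (suc i) (punchIn j l)))

-- Polynomial expressions and the polynomial ring A[V] (free commutative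
-- A-algebra on the variable set V), presented as expressions modulo the
-- congruence generated by the commutative-ring axioms together with the
-- laws saying constants form a ring homomorphic copy of A.

data Expr {a} (A : Set a) (V : Set) : Set a where
  con : A → Expr A V
  var : V → Expr A V
  _⊕_ : Expr A V → Expr A V → Expr A V
  _⊗_ : Expr A V → Expr A V → Expr A V
  ⊖_  : Expr A V → Expr A V

subst : ∀ {a} {A : Set a} {V W : Set} → (V → Expr A W) → Expr A V → Expr A W
subst σ (con x) = con x
subst σ (var v) = σ v
subst σ (e ⊕ f) = subst σ e ⊕ subst σ f
subst σ (e ⊗ f) = subst σ e ⊗ subst σ f
subst σ (⊖ e)   = ⊖ subst σ e

module PolyOps {a e} {A : Set a} (_≈A_ : A → A → Set e)
               (_+_ _*_ : A → A → A) (-_ : A → A) (0# 1# : A) where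

  eval : ∀ {V : Set} → (V → A) → Expr A V → A
  eval ρ (con x) = x
  eval ρ (var v) = ρ v
  eval ρ (e ⊕ f) = eval ρ e + eval ρ f
  eval ρ (e ⊗ f) = eval ρ e * eval ρ f
  eval ρ (⊖ e)   = - eval ρ e

  data _≋_ {V : Set} : Expr A V → Expr A V → Set (a ⊔ e) where
    ≋-refl  : ∀ {x} → x ≋ x
    ≋-sym   : ∀ {x y} → x ≋ y → y ≋ x
    ≋-trans : ∀ {x y z} → x ≋ y → y ≋ z → x ≋ z
    ⊕-cong  : ∀ {x y u v} → x ≋ y → u ≋ v → (x ⊕ u) ≋ (y ⊕ v)
    ⊗-cong  : ∀ {x y u v} → x ≋ y → u ≋ v → (x ⊗ u) ≋ (y ⊗ v)
    ⊖-cong  : ∀ {x y} → x ≋ y → (⊖ x) ≋ (⊖ y)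
    ⊕-assoc : ∀ x y z → ((x ⊕ y) ⊕ z) ≋ (x ⊕ (y ⊕ z))
    ⊕-comm  : ∀ x y → (x ⊕ y) ≋ (y ⊕ x)
    ⊕-identityˡ : ∀ x → (con 0# ⊕ x) ≋ x
    ⊕-inverseˡ  : ∀ x → ((⊖ x) ⊕ x) ≋ con 0#
    ⊗-assoc : ∀ x y z → ((x ⊗ y) ⊗ z) ≋ (x ⊗ (y ⊗ z))
    ⊗-comm  : ∀ x y → (x ⊗ y) ≋ (y ⊗ x)
    ⊗-identityˡ : ∀ x → (con 1# ⊗ x) ≋ x
    distribˡ : ∀ x y z → (x ⊗ (y ⊕ z)) ≋ ((x ⊗ y) ⊕ (x ⊗ z))
    con-cong : ∀ {p q} → p ≈A q → con p ≋ con q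
    con-+ : ∀ p q → con (p + q) ≋ (con p ⊕ con q)
    con-* : ∀ p q → con (p * q) ≋ (con p ⊗ con q)
    con-- : ∀ p → con (- p) ≋ (⊖ con p)

module _ {c ℓ} (R : CommutativeRing c ℓ) where
  open CommutativeRing R

  IsIntegralDomain : Set (c ⊔ ℓ)
  IsIntegralDomain = (¬ (1# ≈ 0#)) × (∀ a b → (a * b) ≈ 0# → (a ≈ 0#) ⊎ (b ≈ 0#))

  record IsIdeal (I : Carrier → Set (c ⊔ ℓ)) : Set (c ⊔ ℓ) where
    field
      resp     : ∀ {x y} → x ≈ y → I x → I y
      zero∈    : I 0#
      +-closed : ∀ {x y} → I x → I y → I (x + y)
      *-closed : ∀ r {x} → I x → I (r * x)

  IsPrincipal : (Carrier → Set (c ⊔ ℓ)) → Set (c ⊔ ℓ)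
  IsPrincipal I = ∃ λ g → ∀ x → (I x → ∃ λ r → x ≈ (r * g)) × ((∃ λ r → x ≈ (r * g)) → I x)

  IsPID : Set (Level.suc (c ⊔ ℓ))
  IsPID = IsIntegralDomain × (∀ I → IsIdeal I → IsPrincipal I)

module Grassmann {c ℓ} (R : CommutativeRing c ℓ) (dom : IsIntegralDomain R) where
  open CommutativeRing R

  private
    nz* : ∀ {b d} → ¬ (b ≈ 0#) → ¬ (d ≈ 0#) → ¬ ((b * d) ≈ 0#)
    nz* b≠0 d≠0 bd=0 with proj₂ dom _ _ bd=0
    ... | inj₁ p = b≠0 p
    ... | inj₂ p = d≠0 p

  K : Set (c ⊔ ℓ)
  K = Σ (Carrier × Carrier) λ p → ¬ (proj₂ p ≈ 0#)

  _≈K_ : K → K → Set ℓ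
  ((a , b) , _) ≈K ((c' , d) , _) = (a * d) ≈ (c' * b)

  _+K_ : K → K → K
  ((a , b) , nb) +K ((c' , d) , nd) = ((a * d) + (c' * b) , b * d) , nz* nb nd

  _*K_ : K → K → K
  ((a , b) , nb) *K ((c' , d) , nd) = ((a * c') , b * d) , nz* nb nd

  -K_ : K → K
  -K ((a , b) , nb) = ((- a) , b) , nb

  ι : Carrier → K
  ι r = (r , 1#) , proj₁ dom

  0K 1K : K
  0K = ι 0#
  1K = ι 1#

  open DetOps _+_ _*_ -_ 0# 1# public renaming (det to detR)

  open PolyOps _≈K_ _+K_ _*K_ -K_ 0K 1K public

  Index : ℕ → ℕ → Set
  Index k n = Σ (Fin k → Fin n) λ f → ∀ i j → i < j → f i < f j

  genericMinor : ∀ {k n} → Index k n → Expr K (Fin k × Fin n)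
  genericMinor {k} {n} I =
    DetOps.det _⊕_ _⊗_ ⊖_ (con 0K) (con 1K) (λ i j → var (i , proj₁ I j))

  -- ψ : A_{k,n} → K given by values on the t_I: it must kill ker(p : T → P)
  IsSpecialization : ∀ k n → (Index k n → K) → Set (c ⊔ ℓ)
  IsSpecialization k n ψ =
    ∀ (f : Expr K (Index k n)) → subst genericMinor f ≋ con 0K → eval ψ f ≈K 0K

{-# OPTIONS --safe #-}
-- Fix I₀ = {1,…,k}. Replacing one index of I₀ by j gives signed coordinates N i j ∈ R, which for
-- generic minors are the entries of adj(X_I₀) X. Cramer's rule and multiplicativity of the determinant
-- give the relation t_I₀ |N_I| = t_I₀^k t_I, so the specialization satisfies it too. The columns of N
-- span a submodule of R^k, which over a PID is generated by k vectors: N = H Y with H = N C. Every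
-- t_I₀ |N_I| is a multiple of t_I₀^k, hence so is t_I₀ |H|, say t_I₀ |H| = e t_I₀^k. Cancelling t_I₀^k
-- leaves e |Y_I| = t_I, and scaling the first row of Y by e gives the representation.
module Submission where

open import Defs
open import Level using (_⊔_)
open import Data.Nat using (ℕ; zero; suc; _≤_; s≤s; z≤n; s<s; z<s) renaming (_+_ to _ℕ+_)
import Data.Nat.Properties as ℕ
open import Data.Fin using (Fin; zero; suc; toℕ; punchIn; punchOut; inject₁; inject≤; _<_; _≟_)
open import Data.Fin.Properties using (<-cmp; <-trans; toℕ-injective; toℕ<n; toℕ-inject≤; suc-injective; punchInᵢ≢i; punchIn-injective; punchIn-punchOut)
open import Data.Vec.Functional using (Vector; []; _∷_; head; tail)
open import Data.Product using (∃; _×_; _,_; proj₁; proj₂)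
open import Data.Sum using (inj₁; inj₂)
open import Function using (_∘_)
open import Algebra.Bundles using (CommutativeRing; RawRing)
open import Relation.Nullary using (¬_; yes; no; contradiction)
open import Relation.Binary.Definitions using (tri<; tri≈; tri>)
open import Relation.Binary.PropositionalEquality as ≡ using (_≡_; _≢_; _≗_)

-- The specialization assigns values to minors only; the entries of a generic matrix have none in
-- general, so a matrix over R has to be assembled from minors, and adj(X_I₀) X is the natural
-- candidate. Its maximal minors come out too large by the factor t_I₀^(k-1), and dividing a row by
-- that power may leave R. H is the remedy: |N_I| = |H| |Y_I|, while the columns of H are
-- combinations of those of N, so |H| generates the ideal of maximal minors of N and collects the
-- whole excess. The spare t_I₀ on both sides of the relation stays until the end because removing
-- it earlier would mean cancelling a determinant in the polynomial ring. Expanding |NC| by columns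
-- yields minors at arbitrary sequences of columns, whereas T has variables for increasing ones
-- only; an induction that sorts by adjacent exchanges bridges the gap.

-- The transposition `τ j` of positions j and j + 1, and deletion of a position.

τ : ∀ {m} → Fin m → Fin (suc m) → Fin (suc m)
τ zero    zero          = suc zero
τ zero    (suc zero)    = zero
τ zero    (suc (suc l)) = suc (suc l)
τ (suc j) zero          = zero
τ (suc j) (suc l)       = suc (τ j l)

τ-punchIn-inject₁ : ∀ {m} (j x : Fin m) → τ j (punchIn (inject₁ j) x) ≡ punchIn (suc j) x
τ-punchIn-inject₁ zero    zero    = ≡.refl
τ-punchIn-inject₁ zero    (suc x) = ≡.refl
τ-punchIn-inject₁ (suc j) zero    = ≡.refl
τ-punchIn-inject₁ (suc j) (suc x) = ≡.cong suc (τ-punchIn-inject₁ j x)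

τ-punchIn-suc : ∀ {m} (j x : Fin m) → τ j (punchIn (suc j) x) ≡ punchIn (inject₁ j) x
τ-punchIn-suc zero    zero    = ≡.refl
τ-punchIn-suc zero    (suc x) = ≡.refl
τ-punchIn-suc (suc j) zero    = ≡.refl
τ-punchIn-suc (suc j) (suc x) = ≡.cong suc (τ-punchIn-suc j x)

τ-inject₁ : ∀ {m} (j : Fin m) → τ j (inject₁ j) ≡ suc j
τ-inject₁ zero    = ≡.refl
τ-inject₁ (suc j) = ≡.cong suc (τ-inject₁ j)

τ-suc : ∀ {m} (j : Fin m) → τ j (suc j) ≡ inject₁ j
τ-suc zero    = ≡.refl
τ-suc (suc j) = ≡.cong suc (τ-suc j)

-- How deleting column l interacts with exchanging columns j and j + 1.
data Position : ∀ {m} → Fin m → Fin (suc m) → Set where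
  left  : ∀ {m} {j : Fin m} → Position j (inject₁ j)
  right : ∀ {m} {j : Fin m} → Position j (suc j)
  away  : ∀ {m} {j : Fin (suc m)} {l : Fin (suc (suc m))} (j′ : Fin m) → τ j l ≡ l →
          (∀ x → τ j (punchIn l x) ≡ punchIn l (τ j′ x)) → Position j l

position : ∀ {m} (j : Fin m) (l : Fin (suc m)) → Position j l
position zero zero = left
position zero (suc zero) = right
position {suc (suc m)} zero (suc (suc l)) = away zero ≡.refl λ
  { zero → ≡.refl ; (suc zero) → ≡.refl ; (suc (suc x)) → ≡.refl }
position {suc (suc m)} (suc j) zero = away j ≡.refl λ x → ≡.refl
position (suc j) (suc l) with position j l
... | left = left
... | right = right
... | away j′ p q = away (suc j′) (≡.cong suc p) λ { zero → ≡.refl ; (suc x) → ≡.cong suc (q x) }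

-- Increasing sequences and sorting by adjacent exchanges.

Increasing : ∀ {m n} → Vector (Fin n) m → Set
Increasing f = ∀ i j → i < j → f i < f j

∷-increasing : ∀ {m n} {x : Fin n} {f : Vector (Fin n) m} →
               (∀ i → x < f i) → Increasing f → Increasing (x ∷ f)
∷-increasing x<f inc zero    (suc j) _         = x<f j
∷-increasing x<f inc (suc i) (suc j) (s<s i<j) = inc i j i<j

tail-increasing : ∀ {m n} {f : Vector (Fin n) (suc m)} → Increasing f → Increasing (tail f)
tail-increasing inc i j i<j = inc (suc i) (suc j) (s<s i<j)

head-least : ∀ {m n} {f : Vector (Fin n) (suc m)} → Increasing f →
             ∀ {x} → x < head f → ∀ i → x < f i
head-least inc x<f zero    = x<f
head-least inc x<f (suc i) = <-trans x<f (inc zero (suc i) z<s)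

-- The instance `AdjacentSwap f f` encodes that two neighbouring entries of `f` agree.
data AdjacentSwap {b} {B : Set b} : ∀ {m} → Vector B m → Vector B m → Set b where
  exchange : ∀ {m} {f g : Vector B (suc m)} (j : Fin m) → g ≗ f ∘ τ j → AdjacentSwap f g

∷-swap : ∀ {b} {B : Set b} {m} x {f g : Vector B m} → AdjacentSwap f g → AdjacentSwap (x ∷ f) (x ∷ g)
∷-swap x (exchange j p) = exchange (suc j) λ { zero → ≡.refl ; (suc i) → p i }

∷-cong : ∀ {b} {B : Set b} {m} x {f g : Vector B m} → f ≗ g → x ∷ f ≗ x ∷ g
∷-cong x p zero    = ≡.refl
∷-cong x p (suc i) = p i

-- What an alternating expression satisfies. `Q` may carry data, as `Lift` does, so these are
-- operations on witnesses and not only properties.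
record SwapClosed {q b} {B : Set b} {m} (Q : Vector B m → Set q) : Set (q ⊔ b) where
  field
    resp   : ∀ {f g} → f ≗ g → Q g → Q f
    swap   : ∀ {f g} → AdjacentSwap f g → Q g → Q f
    repeat : ∀ {f} → AdjacentSwap f f → Q f

∷-closed : ∀ {q b} {B : Set b} {m} {Q : Vector B (suc m) → Set q} x →
           SwapClosed Q → SwapClosed (Q ∘ (x ∷_))
∷-closed x Q-closed = record
  { resp   = λ p → resp (∷-cong x p)
  ; swap   = λ p → swap (∷-swap x p)
  ; repeat = λ p → repeat (∷-swap x p)
  } where open SwapClosed Q-closed

-- The lower-bound condition on g is what lets the recursive call put head f back in front.
insertion : ∀ {q m n} {Q : Vector (Fin n) (suc m) → Set q} → SwapClosed Q →
            ∀ x {f} → Increasing f →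
            (∀ {g} → Increasing g → (∀ {y : Fin n} → y < x → (∀ i → y < f i) → ∀ i → y < g i) → Q g) →
            Q (x ∷ f)
insertion {m = zero} closed x inc base =
  base (λ { zero zero () }) λ { y<x y<f zero → y<x }
insertion {m = suc m} {Q = Q} closed x {f} inc base with <-cmp x (head f)
... | tri< x<f _ _ = base (∷-increasing (head-least inc x<f) inc)
                          λ { y<x y<f zero → y<x ; y<x y<f (suc i) → y<f i }
... | tri≈ _ ≡.refl _ = SwapClosed.repeat closed
                        (exchange zero λ { zero → ≡.refl ; (suc zero) → ≡.refl ; (suc (suc i)) → ≡.refl })
... | tri> _ _ f<x =
  SwapClosed.swap closed
    (exchange {g = head f ∷ (x ∷ tail f)} zero
      λ { zero → ≡.refl ; (suc zero) → ≡.refl ; (suc (suc i)) → ≡.refl })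
    (insertion (∷-closed {Q = Q} (head f) closed) x (tail-increasing inc) λ inc-g bound →
      base (∷-increasing (bound f<x (λ i → inc zero (suc i) z<s)) inc-g)
           λ { y<x y<f zero    → y<f zero
             ; y<x y<f (suc i) → bound y<x (λ i → y<f (suc i)) i })

-- Insertion sort read as an induction principle: an entry out of order is paid for by `swap`, a tie
-- is settled by `repeat`, and only strictly increasing sequences remain as base cases.
sorting : ∀ {q m n} {Q : Vector (Fin n) m → Set q} → SwapClosed Q →
          (∀ {f} → Increasing f → Q f) → ∀ f → Q f
sorting {m = zero} closed base f = base λ ()
sorting {m = suc m} {Q = Q} closed base f =
  SwapClosed.resp closed (λ { zero → ≡.refl ; (suc i) → ≡.refl })
    (sorting {Q = Q ∘ (head f ∷_)} (∷-closed {Q = Q} (head f) closed)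
      (λ inc → insertion closed (head f) inc λ inc-g _ → base inc-g) (tail f))

increasing-lower : ∀ {m n} {f : Vector (Fin n) (suc m)} → Increasing f →
                   ∀ i → toℕ (f zero) ℕ+ toℕ i ≤ toℕ (f i)
increasing-lower {f = f} inc zero = ℕ.≤-reflexive (ℕ.+-identityʳ (toℕ (f zero)))
increasing-lower {m = suc m} {f = f} inc (suc i) = begin
  toℕ (f zero) ℕ+ suc (toℕ i)     ≡⟨ ℕ.+-suc (toℕ (f zero)) (toℕ i) ⟩
  suc (toℕ (f zero)) ℕ+ toℕ i     ≤⟨ ℕ.+-monoˡ-≤ (toℕ i) (inc zero (suc zero) z<s) ⟩
  toℕ (f (suc zero)) ℕ+ toℕ i     ≤⟨ increasing-lower (tail-increasing inc) i ⟩
  toℕ (f (suc i))                ∎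
  where open ℕ.≤-Reasoning

increasing-upper : ∀ {m n} {f : Vector (Fin n) m} → Increasing f →
                   ∀ i → toℕ (f i) ℕ+ m ≤ n ℕ+ toℕ i
increasing-upper {suc zero} {n} {f} inc zero = begin
  toℕ (f zero) ℕ+ 1  ≡⟨ ℕ.+-comm (toℕ (f zero)) 1 ⟩
  suc (toℕ (f zero))  ≤⟨ toℕ<n (f zero) ⟩
  n  ≡⟨ ℕ.+-identityʳ n ⟨
  n ℕ+ 0 ∎
  where open ℕ.≤-Reasoning
increasing-upper {suc (suc m)} {n} {f} inc zero = begin
  toℕ (f zero) ℕ+ suc (suc m)      ≡⟨ ℕ.+-suc (toℕ (f zero)) (suc m) ⟩
  suc (toℕ (f zero)) ℕ+ suc m      ≤⟨ ℕ.+-monoˡ-≤ (suc m) (inc zero (suc zero) z<s) ⟩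
  toℕ (f (suc zero)) ℕ+ suc m      ≤⟨ increasing-upper (tail-increasing inc) zero ⟩
  n ℕ+ 0                           ∎
  where open ℕ.≤-Reasoning
increasing-upper {suc m} {n} {f} inc (suc i) = begin
  toℕ (f (suc i)) ℕ+ suc m    ≡⟨ ℕ.+-suc (toℕ (f (suc i))) m ⟩
  suc (toℕ (f (suc i)) ℕ+ m)  ≤⟨ s≤s (increasing-upper (tail-increasing inc) i) ⟩
  suc (n ℕ+ toℕ i)            ≡⟨ ℕ.+-suc n (toℕ i) ⟨
  n ℕ+ suc (toℕ i)            ∎
  where open ℕ.≤-Reasoning

-- With as many positions as values the lower and upper bounds meet. Hence sorting the columns of a
-- square matrix leaves a single base case.
increasing⇒id : ∀ {m} {f : Vector (Fin m) m} → Increasing f → ∀ i → f i ≡ i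
increasing⇒id {suc m} {f} inc i = toℕ-injective (ℕ.≤-antisym
  (ℕ.+-cancelʳ-≤ (suc m) _ _ (ℕ.≤-trans (increasing-upper inc i) (ℕ.≤-reflexive (ℕ.+-comm (suc m) (toℕ i)))))
  (ℕ.≤-trans (ℕ.m≤n+m (toℕ i) (toℕ (f zero))) (increasing-lower inc i)))

increasing⇒≤ : ∀ {m n} {f : Vector (Fin n) m} → Increasing f → m ≤ n
increasing⇒≤ {zero} inc = z≤n
increasing⇒≤ {suc m} {n} {f} inc =
  ℕ.≤-trans (ℕ.m≤n+m (suc m) (toℕ (f zero)))
    (ℕ.≤-trans (increasing-upper inc zero) (ℕ.≤-reflexive (ℕ.+-identityʳ n)))

-- Relations between rings and the determinants they transport.

module _ {a b r ℓ₁ ℓ₂} (A : RawRing a ℓ₁) (B : RawRing b ℓ₂)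
         (_∼_ : RawRing.Carrier A → RawRing.Carrier B → Set r) where
  private
    module A = RawRing A
    module B = RawRing B
    module DA = DetOps A._+_ A._*_ A.-_ A.0# A.1#
    module DB = DetOps B._+_ B._*_ B.-_ B.0# B.1#

  -- A relation in place of a homomorphism: it covers congruence, `subst`, and "this expression
  -- evaluates to that element of R", which is only partial, since evaluation takes values among
  -- fractions.
  record IsRingRelation : Set (a ⊔ b ⊔ r) where
    field
      +-rel : ∀ {x y u v} → x ∼ u → y ∼ v → (x A.+ y) ∼ (u B.+ v)
      *-rel : ∀ {x y u v} → x ∼ u → y ∼ v → (x A.* y) ∼ (u B.* v)
      neg-rel : ∀ {x u} → x ∼ u → (A.- x) ∼ (B.- u)
      0-rel : A.0# ∼ B.0#
      1-rel : A.1# ∼ B.1#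

    altSum-rel : ∀ {m} {f : Vector A.Carrier m} {g : Vector B.Carrier m} →
                 (∀ i → f i ∼ g i) → DA.altSum f ∼ DB.altSum g
    altSum-rel {zero}  p = 0-rel
    altSum-rel {suc m} p = +-rel (p zero) (neg-rel (altSum-rel (p ∘ suc)))

    det-rel : ∀ {m} {M : Fin m → Fin m → A.Carrier} {N : Fin m → Fin m → B.Carrier} →
              (∀ i j → M i j ∼ N i j) → DA.det M ∼ DB.det N
    det-rel {zero}  p = 1-rel
    det-rel {suc m} p = altSum-rel λ j → *-rel (p zero j) (det-rel λ i l → p (suc i) (punchIn j l))

-- The scalar matrix over a bare set, so that the same formula serves R, P and T. Its determinant
-- replaces the power of x and is transported by `det-rel` like any other determinant.
diag : ∀ {a} {A : Set a} (0# x : A) {m} → Fin m → Fin m → A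
diag 0# x zero    zero    = x
diag 0# x zero    (suc j) = 0#
diag 0# x (suc i) zero    = 0#
diag 0# x (suc i) (suc j) = diag 0# x i j

-- Determinants over a commutative ring: linearity in a column.

module Determinant {c ℓ} (A : CommutativeRing c ℓ) where
  open CommutativeRing A hiding (zero)
  open import Algebra.Properties.Ring ring
  open import Algebra.Properties.Semiring.Sum semiring
  open import Algebra.Properties.CommutativeSemigroup *-commutativeSemigroup
    using (x∙yz≈y∙xz)
  open import Algebra.Properties.CommutativeSemigroup +-commutativeSemigroup
    using () renaming (interchange to +-interchange; x∙yz≈y∙xz to x+[y+z]≈y+[x+z])
  open import Relation.Binary.Reasoning.Setoid setoid
  open DetOps _+_ _*_ -_ 0# 1# public

  private variable
    m n : ℕ

  ≈-isRingRelation : IsRingRelation rawRing rawRing _≈_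
  ≈-isRingRelation = record
    { +-rel = +-cong ; *-rel = *-cong ; neg-rel = -‿cong ; 0-rel = refl ; 1-rel = refl }

  open IsRingRelation ≈-isRingRelation public
    using () renaming (altSum-rel to altSum-cong; det-rel to det-cong)

  private
    -‿linear : ∀ a b x y → - (a * x + b * y) ≈ a * - x + b * - y
    -‿linear a b x y = begin
      - (a * x + b * y)       ≈⟨ -‿+-comm _ _ ⟨
      - (a * x) + - (b * y)   ≈⟨ +-cong (-‿distribʳ-* a x) (-‿distribʳ-* b y) ⟩
      a * - x + b * - y       ∎

    +-linear : ∀ a b {x y z w} → (a * x + b * y) + (a * z + b * w) ≈ a * (x + z) + b * (y + w)
    +-linear a b {x} {y} {z} {w} = begin
      (a * x + b * y) + (a * z + b * w)  ≈⟨ +-interchange _ _ _ _ ⟩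
      (a * x + a * z) + (b * y + b * w)  ≈⟨ +-cong (distribˡ a x z) (distribˡ b y w) ⟨
      a * (x + z) + b * (y + w)          ∎

    *-linear : ∀ a b x {y z} → x * (a * y + b * z) ≈ a * (x * y) + b * (x * z)
    *-linear a b x {y} {z} = trans (distribˡ x _ _) (+-cong (x∙yz≈y∙xz x a y) (x∙yz≈y∙xz x b z))

    *-linearʳ : ∀ a b x {y z} → (a * y + b * z) * x ≈ a * (y * x) + b * (z * x)
    *-linearʳ a b x {y} {z} = trans (distribʳ x _ _) (+-cong (*-assoc a y x) (*-assoc b z x))

    0-linear : ∀ a b → 0# ≈ a * 0# + b * 0#
    0-linear a b = sym (trans (+-cong (zeroʳ a) (zeroʳ b)) (+-identityˡ 0#))

  altSum-linear : ∀ a b {f g h : Vector Carrier m} → (∀ i → h i ≈ a * f i + b * g i) →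
                  altSum h ≈ a * altSum f + b * altSum g
  altSum-linear {m = zero}  a b p = 0-linear a b
  altSum-linear {m = suc m} a b p =
    trans (+-cong (p zero) (trans (-‿cong (altSum-linear a b (p ∘ suc))) (-‿linear a b _ _)))
          (+-linear a b)

  sum-linear : ∀ a b {f g h : Vector Carrier m} → (∀ i → h i ≈ a * f i + b * g i) →
               sum h ≈ a * sum f + b * sum g
  sum-linear {m = zero}  a b p = 0-linear a b
  sum-linear {m = suc m} a b p = trans (+-cong (p zero) (sum-linear a b (p ∘ suc))) (+-linear a b)

  -- In the expansion along the top row, the term `l = j` is linear through its entry, its minor not
  -- containing column j; every other term is linear through its minor, where column j sits at
  -- `punchOut l≢j`.
  det-column-linear : ∀ {M N P : Fin m → Fin m → Carrier} (j : Fin m) a b →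
    (∀ i l → l ≢ j → P i l ≈ M i l) → (∀ i l → l ≢ j → P i l ≈ N i l) →
    (∀ i → P i j ≈ a * M i j + b * N i j) →
    det P ≈ a * det M + b * det N
  det-column-linear {m = suc m} {M} {N} {P} j a b P≈M P≈N P≈aM+bN = altSum-linear a b term
    where
    minor : (Fin (suc m) → Fin (suc m) → Carrier) → Fin (suc m) → Fin m → Fin m → Carrier
    minor M j i l = M (suc i) (punchIn j l)

    term : ∀ l → P zero l * det (minor P l) ≈
                 a * (M zero l * det (minor M l)) + b * (N zero l * det (minor N l))
    term l with l ≟ j
    ... | yes ≡.refl = begin
      P zero l * det (minor P l)
        ≈⟨ *-congʳ (P≈aM+bN zero) ⟩
      (a * M zero l + b * N zero l) * det (minor P l)
        ≈⟨ *-linearʳ a b _ ⟩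
      a * (M zero l * det (minor P l)) + b * (N zero l * det (minor P l))
        ≈⟨ +-cong (*-congˡ (*-congˡ (det-cong λ i x → P≈M (suc i) _ (punchInᵢ≢i l x))))
                  (*-congˡ (*-congˡ (det-cong λ i x → P≈N (suc i) _ (punchInᵢ≢i l x)))) ⟩
      a * (M zero l * det (minor M l)) + b * (N zero l * det (minor N l)) ∎
    ... | no l≢j = begin
      P zero l * det (minor P l)
        ≈⟨ *-congˡ (det-column-linear (punchOut l≢j) a b
             (λ i x x≢ → P≈M (suc i) _ (off x≢)) (λ i x x≢ → P≈N (suc i) _ (off x≢))
             λ i → ≡.subst (λ z → P (suc i) z ≈ a * M (suc i) z + b * N (suc i) z)
                           (≡.sym (punchIn-punchOut l≢j)) (P≈aM+bN (suc i))) ⟩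
      P zero l * (a * det (minor M l) + b * det (minor N l))
        ≈⟨ *-linear a b _ ⟩
      a * (P zero l * det (minor M l)) + b * (P zero l * det (minor N l))
        ≈⟨ +-cong (*-congˡ (*-congʳ (P≈M zero l l≢j))) (*-congˡ (*-congʳ (P≈N zero l l≢j))) ⟩
      a * (M zero l * det (minor M l)) + b * (N zero l * det (minor N l)) ∎
      where
      off : ∀ {x} → x ≢ punchOut l≢j → punchIn l x ≢ j
      off x≢ eq = x≢ (punchIn-injective l _ _ (≡.trans eq (≡.sym (punchIn-punchOut l≢j))))

  -- Alternation of the determinant in its columns.

  altSum-neg : ∀ {f g : Vector Carrier m} → (∀ i → g i ≈ - f i) → altSum g ≈ - altSum f
  altSum-neg {m = zero}  p = sym -0#≈0#
  altSum-neg {m = suc m} p = trans (+-cong (p zero) (-‿cong (altSum-neg (p ∘ suc)))) (-‿+-comm _ _)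

  altSum-zero : ∀ {f : Vector Carrier m} → (∀ i → f i ≈ 0#) → altSum f ≈ 0#
  altSum-zero {m = zero}  p = refl
  altSum-zero {m = suc m} p =
    trans (+-cong (p zero) (trans (-‿cong (altSum-zero (p ∘ suc))) -0#≈0#)) (+-identityˡ 0#)

  -- Neighbouring terms carry opposite signs, so trading their values negates their joint
  -- contribution.
  altSum-swap : ∀ {f g : Vector Carrier (suc m)} (j : Fin m) →
    g (inject₁ j) ≈ f (suc j) → g (suc j) ≈ f (inject₁ j) →
    (∀ l → l ≢ inject₁ j → l ≢ suc j → g l ≈ - f l) → altSum g ≈ - altSum f
  altSum-swap {m = suc m} {f} {g} zero p q r = begin
    g zero + - (g (suc zero) + - altSum (λ i → g (suc (suc i))))
      ≈⟨ +-cong p (-‿cong (+-cong q (trans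
           (-‿cong (altSum-neg λ i → r (suc (suc i)) (λ ()) (λ ()))) (-‿involutive s)))) ⟩
    f (suc zero) + - (f zero + s)            ≈⟨ +-congˡ (-‿+-comm _ _) ⟨
    f (suc zero) + (- f zero + - s)          ≈⟨ x+[y+z]≈y+[x+z] _ _ _ ⟩
    - f zero + (f (suc zero) + - s)          ≈⟨ +-congˡ (-‿involutive _) ⟨
    - f zero + - - (f (suc zero) + - s)      ≈⟨ -‿+-comm _ _ ⟩
    - (f zero + - (f (suc zero) + - s))      ∎
    where s = altSum (λ i → f (suc (suc i)))
  altSum-swap {m = suc m} {f} {g} (suc j) p q r =
    trans (+-cong (r zero (λ ()) (λ ()))
            (-‿cong (altSum-swap {f = tail f} {tail g} j p q λ l l≢ l≢′ →
              r (suc l) (l≢ ∘ suc-injective) (l≢′ ∘ suc-injective))))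
          (-‿+-comm _ _)

  altSum-repeat : ∀ {f : Vector Carrier (suc m)} (j : Fin m) →
    f (inject₁ j) ≈ f (suc j) → (∀ l → l ≢ inject₁ j → l ≢ suc j → f l ≈ 0#) → altSum f ≈ 0#
  altSum-repeat {m = suc m} {f} zero p r = begin
    f zero + - (f (suc zero) + - altSum (λ i → f (suc (suc i))))
      ≈⟨ +-cong p (-‿cong (trans (+-congˡ (trans
           (-‿cong (altSum-zero λ i → r (suc (suc i)) (λ ()) (λ ()))) -0#≈0#)) (+-identityʳ _))) ⟩
    f (suc zero) + - f (suc zero)            ≈⟨ -‿inverseʳ _ ⟩
    0#                                       ∎
  altSum-repeat {m = suc m} {f} (suc j) p r =
    trans (+-cong (r zero (λ ()) (λ ()))
            (trans (-‿cong (altSum-repeat {f = tail f} j p λ l l≢ l≢′ →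
              r (suc l) (l≢ ∘ suc-injective) (l≢′ ∘ suc-injective))) -0#≈0#))
          (+-identityˡ 0#)

  swap-remove : ∀ {b} {B : Set b} {f g : Vector B (suc (suc m))} {j l} j′ →
    g ≗ f ∘ τ j → (∀ x → τ j (punchIn l x) ≡ punchIn l (τ j′ x)) →
    AdjacentSwap (f ∘ punchIn l) (g ∘ punchIn l)
  swap-remove {f = f} {l = l} j′ p q =
    exchange j′ λ x → ≡.trans (p (punchIn l x)) (≡.cong f (q x))

  module _ {b} {B : Set b} where

    columns : (Fin m → B → Carrier) → Vector B m → Fin m → Fin m → Carrier
    columns M f i j = M i (f j)

    columns-cong : ∀ (M : Fin m → B → Carrier) {f g} → f ≗ g → det (columns M f) ≈ det (columns M g)
    columns-cong M p = det-cong λ i j → reflexive (≡.cong (M i) (p j))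

    -- The two terms that delete an exchanged column trade places, with equal minors; in every other
    -- term the exchange survives inside the minor and induction supplies the sign.
    det-swap : ∀ (M : Fin m → B → Carrier) {f g} → AdjacentSwap f g →
               det (columns M f) ≈ - det (columns M g)
    det-swap M {f} {g} (exchange {m} j p) = altSum-swap j
      (*-cong (reflexive (≡.cong (M zero) (≡.sym (≡.trans (p (suc j)) (≡.cong f (τ-suc j))))))
              (columns-cong (M ∘ suc) λ x → ≡.sym (≡.trans (p _) (≡.cong f (τ-punchIn-suc j x)))))
      (*-cong (reflexive (≡.cong (M zero) (≡.sym (≡.trans (p (inject₁ j)) (≡.cong f (τ-inject₁ j))))))
              (columns-cong (M ∘ suc) λ x → ≡.sym (≡.trans (p _) (≡.cong f (τ-punchIn-inject₁ j x)))))
      other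
      where
      other : ∀ l → l ≢ inject₁ j → l ≢ suc j →
        M zero (f l) * det (columns (M ∘ suc) (f ∘ punchIn l)) ≈
        - (M zero (g l) * det (columns (M ∘ suc) (g ∘ punchIn l)))
      other l l≢ l≢′ with position j l
      ... | left  = contradiction ≡.refl l≢
      ... | right = contradiction ≡.refl l≢′
      ... | away j′ q r = trans
        (*-cong (reflexive (≡.cong (M zero) (≡.sym (≡.trans (p l) (≡.cong f q)))))
                (det-swap (M ∘ suc) (swap-remove {f = f} j′ p r)))
        (sym (-‿distribʳ-* _ _))

    -- `det-swap` would only give that the determinant equals its own negative, which is too weak in
    -- characteristic 2; here the two equal terms cancel directly.
    det-repeat : ∀ (M : Fin m → B → Carrier) {f} → AdjacentSwap f f → det (columns M f) ≈ 0#
    det-repeat M {f} (exchange {m} j p) = altSum-repeat j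
      (*-cong (reflexive (≡.cong (M zero) (≡.trans (p (inject₁ j)) (≡.cong f (τ-inject₁ j)))))
              (columns-cong (M ∘ suc) λ x → ≡.trans (p _) (≡.cong f (τ-punchIn-inject₁ j x))))
      other
      where
      other : ∀ l → l ≢ inject₁ j → l ≢ suc j →
        M zero (f l) * det (columns (M ∘ suc) (f ∘ punchIn l)) ≈ 0#
      other l l≢ l≢′ with position j l
      ... | left  = contradiction ≡.refl l≢
      ... | right = contradiction ≡.refl l≢′
      ... | away j′ q r = trans (*-congˡ (det-repeat (M ∘ suc) (swap-remove {f = f} j′ p r))) (zeroʳ _)

  δ : Fin m → Fin m → Carrier
  δ = diag 0# 1#

  sum-zero : ∀ {f : Vector Carrier m} → (∀ i → f i ≈ 0#) → sum f ≈ 0#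
  sum-zero {m = m} p = trans (sum-cong-≋ p) (sum-replicate-zero m)

  sum-diag : ∀ x (f : Vector Carrier m) i → sum (λ l → diag 0# x i l * f l) ≈ x * f i
  sum-diag {suc m} x f zero    = trans (+-congˡ (sum-zero {m} λ l → zeroˡ _)) (+-identityʳ _)
  sum-diag x f (suc i) = trans (+-cong (zeroˡ _) (sum-diag x (tail f) i)) (+-identityˡ _)

  sum-δ : ∀ (f : Vector Carrier m) i → sum (λ l → f l * δ i l) ≈ f i
  sum-δ {m} f i = trans (sum-cong-≋ {m} λ l → *-comm _ _) (trans (sum-diag 1# f i) (*-identityˡ _))

  det-diag : ∀ m x → det {suc m} (diag 0# x) ≈ x * det {m} (diag 0# x)
  det-diag m x = trans (+-congˡ (trans (-‿cong (altSum-zero {m} λ i → zeroˡ _)) -0#≈0#)) (+-identityʳ _)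

  det-δ : ∀ m → det {m} δ ≈ 1#
  det-δ zero    = refl
  det-δ (suc m) = trans (det-diag m 1#) (trans (*-identityˡ _) (det-δ m))

  -- Multilinear forms up to divisibility, and multiplicativity of the determinant.

  record IsMultilinear (F : (Fin m → Vector Carrier n) → Carrier) : Set (c ⊔ ℓ) where
    field
      F-cong : ∀ {u v} → (∀ j l → u j l ≈ v j l) → F u ≈ F v
      linear : ∀ {u v w} j a b → (∀ i l → i ≢ j → w i l ≈ u i l) → (∀ i l → i ≢ j → w i l ≈ v i l) →
               (∀ l → w j l ≈ a * u j l + b * v j l) → F w ≈ a * F u + b * F v

  _∣_ : Carrier → Carrier → Set (c ⊔ ℓ)
  d ∣ x = ∃ λ q → x ≈ q * d

  ∣-resp : ∀ {d x y} → x ≈ y → d ∣ x → d ∣ y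
  ∣-resp x≈y (q , p) = q , trans (sym x≈y) p

  ∣-linear : ∀ {d x y} a b → d ∣ x → d ∣ y → d ∣ (a * x + b * y)
  ∣-linear a b (q , p) (r , s) = a * q + b * r , (begin
    a * _ + b * _                ≈⟨ +-cong (*-congˡ p) (*-congˡ s) ⟩
    a * (q * _) + b * (r * _)    ≈⟨ *-linearʳ a b _ ⟨
    (a * q + b * r) * _          ∎)

  linear-∣ : ∀ {d} (L : Vector Carrier n → Carrier) →
    (∀ {u v} → (∀ l → u l ≈ v l) → L u ≈ L v) →
    (∀ {u v w} a b → (∀ l → w l ≈ a * u l + b * v l) → L w ≈ a * L u + b * L v) →
    (∀ l → d ∣ L (δ l)) → ∀ u → d ∣ L u
  -- Without coordinates, u = 0 u + 0 u holds vacuously, so linearity itself forces `L u` to vanish.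
  linear-∣ {n = zero} {d} L L-cong L-linear p u = 0# , (begin
    L u                    ≈⟨ L-linear {u} {u} 0# 0# (λ ()) ⟩
    0# * L u + 0# * L u    ≈⟨ +-cong (zeroˡ _) (zeroˡ _) ⟩
    0# + 0#                ≈⟨ +-identityˡ 0# ⟩
    0#                     ≈⟨ zeroˡ d ⟨
    0# * d                 ∎)
  linear-∣ {n = suc n} L L-cong L-linear p u =
    ∣-resp (sym (L-linear (u zero) 1# split)) (∣-linear (u zero) 1# (p zero) rest)
    where
    split : ∀ l → u l ≈ u zero * δ zero l + 1# * (0# ∷ tail u) l
    split zero = sym (trans (+-cong (*-identityʳ _) (zeroʳ _)) (+-identityʳ _))
    split (suc l) = sym (trans (+-cong (zeroʳ _) (*-identityˡ _)) (+-identityˡ _))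

    rest = linear-∣ (λ v → L (0# ∷ v))
      (λ q → L-cong λ { zero → refl ; (suc l) → q l })
      (λ a b q → L-linear a b λ { zero → 0-linear a b ; (suc l) → q l })
      (λ l → ∣-resp (L-cong λ { zero → refl ; (suc l) → refl }) (p (suc l)))
      (tail u)

  -- Divisibility survives each linear combination, so slots are expanded one at a time and the sum
  -- over all `f` is never written. With d = 0 this becomes a uniqueness principle: a form that
  -- vanishes on all tuples of basis vectors is zero.
  multilinear-∣ : ∀ {d} {F : (Fin m → Vector Carrier n) → Carrier} → IsMultilinear F →
    (∀ (f : Vector (Fin n) m) → d ∣ F (λ j → δ (f j))) → ∀ v → d ∣ F v
  multilinear-∣ {m = zero} ml p v =
    ∣-resp (IsMultilinear.F-cong ml (λ ())) (p [])
  multilinear-∣ {m = suc m} {F = F} ml p v =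
    ∣-resp (F-cong λ { zero l → refl ; (suc j) l → refl })
      (multilinear-∣ {F = λ w → F (v zero ∷ w)} (record
        { F-cong = λ q → F-cong λ { zero l → refl ; (suc j) l → q j l }
        ; linear = λ j a b q r s → linear (suc j) a b
            (λ { zero l _ → refl ; (suc i) l i≢ → q i l (i≢ ∘ ≡.cong suc) })
            (λ { zero l _ → refl ; (suc i) l i≢ → r i l (i≢ ∘ ≡.cong suc) }) s
        })
        (λ f → linear-∣ (λ x → F (x ∷ λ j → δ (f j)))
          (λ q → F-cong λ { zero l → q l ; (suc j) l → refl })
          (λ a b q → linear zero a b
            (λ { zero l 0≢0 → contradiction ≡.refl 0≢0 ; (suc i) l _ → refl })
            (λ { zero l 0≢0 → contradiction ≡.refl 0≢0 ; (suc i) l _ → refl }) q)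
          (λ l → ∣-resp (F-cong λ { zero _ → refl ; (suc j) _ → refl }) (p (l ∷ f)))
          (v zero))
        (tail v))
    where open IsMultilinear ml

  _·_ : (Fin m → Fin n → Carrier) → Vector Carrier n → Vector Carrier m
  (N · v) i = sum (λ l → N i l * v l)

  det-multilinear : ∀ x (N : Fin m → Fin n → Carrier) →
    IsMultilinear (λ v → x * det (λ i j → (N · v j) i))
  det-multilinear {n = n} x N = record
    { F-cong = λ p → *-congˡ (det-cong λ i j → sum-cong-≋ {n} λ l → *-congˡ (p j l))
    ; linear = λ j a b p q r → trans (*-congˡ (det-column-linear j a b
        (λ i l l≢j → sum-cong-≋ {n} λ l′ → *-congˡ (p l l′ l≢j))
        (λ i l l≢j → sum-cong-≋ {n} λ l′ → *-congˡ (q l l′ l≢j))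
        (λ i → sum-linear {n} a b λ l → trans (*-congˡ (r l)) (*-linear a b _))))
        (*-linear a b x)
    }

  +-multilinear : ∀ {F G : (Fin m → Vector Carrier n) → Carrier} →
    IsMultilinear F → IsMultilinear G → IsMultilinear (λ v → F v + G v)
  +-multilinear mF mG = record
    { F-cong = λ p → +-cong (F.F-cong p) (G.F-cong p)
    ; linear = λ j a b p q r → trans (+-cong (F.linear j a b p q r) (G.linear j a b p q r)) (+-linear a b)
    }
    where module F = IsMultilinear mF
          module G = IsMultilinear mG

  -- Cauchy-Binet in divisibility form: on basis vectors, `N · δ (f j)` is column `f j` of `N`.
  minors-∣ : ∀ {d} x (N : Fin m → Fin n → Carrier) →
    (∀ f → d ∣ (x * det (columns N f))) → ∀ v → d ∣ (x * det (λ i j → (N · v j) i))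
  minors-∣ x N p = multilinear-∣ (det-multilinear x N)
    λ f → ∣-resp (*-congˡ (det-cong λ i j → sym (sum-δ (N i) (f j)))) (p f)

  0∣⇒≈0 : ∀ {x} → 0# ∣ x → x ≈ 0#
  0∣⇒≈0 (q , p) = trans p (zeroʳ q)

  -- Both sides alternate in `f`, and sorting leaves the identity. The factor `det (columns δ f)`
  -- acts as the sign of `f`, and is zero when `f` repeats a value.
  det-columns : ∀ (H : Fin m → Fin m → Carrier) f → det (columns H f) ≈ det H * det (columns δ f)
  det-columns {m} H = sorting closed λ inc → begin
    det (columns H _)          ≈⟨ columns-cong H (increasing⇒id inc) ⟩
    det H                      ≈⟨ *-identityʳ _ ⟨
    det H * 1#                 ≈⟨ *-congˡ (det-δ m) ⟨
    det H * det {m} δ          ≈⟨ *-congˡ (columns-cong {m = m} δ (increasing⇒id inc)) ⟨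
    det H * det (columns {m = m} δ _)  ∎
    where
    closed : SwapClosed (λ f → det (columns H f) ≈ det H * det (columns δ f))
    closed = record
      { resp = λ p q → trans (columns-cong H p) (trans q (*-congˡ (sym (columns-cong {m = m} δ p))))
      ; swap = λ s q → trans (det-swap H s) (trans (-‿cong q)
                 (trans (-‿distribʳ-* _ _) (*-congˡ (sym (det-swap {m = m} δ s)))))
      ; repeat = λ s → trans (det-repeat H s) (sym (trans (*-congˡ (det-repeat {m = m} δ s)) (zeroʳ _)))
      }

  -- The difference of the two sides is multilinear in the columns of `Y` and vanishes on basis
  -- vectors by `det-columns`; `multilinear-∣` with divisor 0 then kills it. The factors `1#` and
  -- `δ` only bring both terms into the shape of `det-multilinear`.
  det-* : ∀ (H Y : Fin m → Fin m → Carrier) →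
          det (λ i j → sum (λ l → H i l * Y l j)) ≈ det H * det Y
  det-* {m} H Y = begin
    det (λ i j → (H · y j) i)                    ≈⟨ *-identityˡ _ ⟨
    1# * det (λ i j → (H · y j) i)               ≈⟨ +-inverseˡ-unique _ _ difference≈0 ⟩
    - (- det H * det (λ i j → (δ · y j) i))      ≈⟨ -‿cong (sym (-‿distribˡ-* _ _)) ⟩
    - - (det H * det (λ i j → (δ · y j) i))      ≈⟨ -‿involutive _ ⟩
    det H * det (λ i j → (δ · y j) i)
      ≈⟨ *-congˡ (det-cong λ i j → trans (sum-diag 1# (y j) i) (*-identityˡ _)) ⟩
    det H * det Y                                ∎
    where
    y : Fin m → Vector Carrier m
    y j l = Y l j

    difference≈0 : 1# * det (λ i j → (H · y j) i) + - det H * det (λ i j → (δ · y j) i) ≈ 0#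
    difference≈0 = 0∣⇒≈0 (multilinear-∣
      (+-multilinear (det-multilinear 1# H) (det-multilinear (- det H) δ))
      (λ f → 0# , (begin
        1# * det (λ i j → (H · δ (f j)) i) + - det H * det (λ i j → (δ · δ (f j)) i)
          ≈⟨ +-cong (trans (*-identityˡ _) (det-cong λ i j → sum-δ (H i) (f j)))
                    (*-congˡ (det-cong λ i j → sum-δ (δ i) (f j))) ⟩
        det (columns H f) + - det H * det (columns {m = m} δ f)
          ≈⟨ +-cong (det-columns H f) (sym (-‿distribˡ-* _ _)) ⟩
        det H * det (columns {m = m} δ f) + - (det H * det (columns {m = m} δ f))
          ≈⟨ -‿inverseʳ _ ⟩
        0#
          ≈⟨ zeroˡ 0# ⟨
        0# * 0# ∎))
      y)

  -- Cramer's rule and the minors of the adjugate product.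

  module _ {b} {B : Set b} where

    -- Alternation is available in columns, not rows. So the matrix is factored as `E` times `M`,
    -- where `E` has m + 1 rows but m columns: any choice of m + 1 columns of `E` repeats one, so
    -- all its maximal minors vanish.
    det-duplicate-row : ∀ (M : Fin m → B → Carrier) r f → det (columns (M r ∷ M) f) ≈ 0#
    det-duplicate-row {m} M r f = begin
      det (columns (M r ∷ M) f)
        ≈⟨ det-cong {suc m} {columns (M r ∷ M) f} {λ i j → (E · (λ l → M l (f j))) i}
             (λ { zero j → row r j ; (suc i) j → row i j }) ⟩
      det (λ i j → (E · (λ l → M l (f j))) i)
        ≈⟨ *-identityˡ _ ⟨
      1# * det (λ i j → (E · (λ l → M l (f j))) i)
        ≈⟨ 0∣⇒≈0 (minors-∣ 1# E
             (λ g → 0# , trans (*-identityˡ _) (trans (sorting closed no-increasing g) (sym (zeroˡ 0#))))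
             (λ j l → M l (f j))) ⟩
      0# ∎
      where
      E : Fin (suc m) → Fin m → Carrier
      E = δ r ∷ δ

      row : ∀ i j → M i (f j) ≈ (δ · (λ l → M l (f j))) i
      row i j = sym (trans (sum-diag 1# _ i) (*-identityˡ _))

      closed : SwapClosed (λ g → det (columns E g) ≈ 0#)
      closed = record
        { resp   = λ p q → trans (columns-cong E p) q
        ; swap   = λ s q → trans (det-swap E s) (trans (-‿cong q) -0#≈0#)
        ; repeat = λ s → det-repeat E s
        }

      no-increasing : ∀ {g : Vector (Fin m) (suc m)} → Increasing g → det (columns E g) ≈ 0#
      no-increasing inc = contradiction (increasing⇒≤ inc) ℕ.1+n≰n

    -- Expand the vanishing determinant of `M r ∷ M` in the columns `x ∷ f` along its top row: the
    -- first term is the right-hand side, the others form the negated sum.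
    cramer-altSum : ∀ (M : Fin (suc m) → B → Carrier) r x f →
      altSum (λ i → M r (f i) * det (columns M (x ∷ f ∘ punchIn i))) ≈ det (columns M f) * M r x
    cramer-altSum {m} M r x f = begin
      altSum (λ i → M r (f i) * det (columns M (x ∷ f ∘ punchIn i)))
        ≈⟨ altSum-cong {suc m} (λ i → *-congˡ {M r (f i)} (same i)) ⟩
      S                                        ≈⟨ -‿involutive _ ⟨
      - - S                                    ≈⟨ +-inverseˡ-unique _ _ (det-duplicate-row M r (x ∷ f)) ⟨
      M r x * det (columns M f)                ≈⟨ *-comm _ _ ⟩
      det (columns M f) * M r x                ∎
      where
      S = altSum (λ i → M r (f i) * det (columns M ((x ∷ f) ∘ punchIn (suc i))))

      same : ∀ i → det (columns M (x ∷ f ∘ punchIn i)) ≈ det (columns M ((x ∷ f) ∘ punchIn (suc i)))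
      same i = columns-cong M {x ∷ f ∘ punchIn i} {(x ∷ f) ∘ punchIn (suc i)} λ { zero → ≡.refl ; (suc j) → ≡.refl }

  signed : Fin m → Carrier → Carrier
  signed zero    x = x
  signed (suc i) x = - signed i x

  altSum≈sum : ∀ (f g : Vector Carrier m) →
    altSum (λ i → f i * g i) ≈ sum (λ i → f i * signed i (g i))
  altSum≈sum {zero}  f g = refl
  altSum≈sum {suc m} f g = +-congˡ (begin
    - altSum (λ i → f (suc i) * g (suc i))              ≈⟨ -‿cong (altSum≈sum (tail f) (tail g)) ⟩
    - sum (λ i → f (suc i) * signed i (g (suc i)))      ≈⟨ -1*x≈-x _ ⟨
    - 1# * sum (λ i → f (suc i) * signed i (g (suc i)))
      ≈⟨ *-distribˡ-sum (- 1#) (λ i → f (suc i) * signed i (g (suc i))) ⟩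
    sum (λ i → - 1# * (f (suc i) * signed i (g (suc i))))
      ≈⟨ sum-cong-≋ {m} (λ i → trans (-1*x≈-x _) (-‿distribʳ-* _ _)) ⟩
    sum (λ i → f (suc i) * signed (suc i) (g (suc i)))  ∎)

  -- Multiplying by the adjugate of the columns f, and taking determinants, gives the relation
  -- |M_f| |A_h| = |M_f|^k |M_h| between maximal minors; the power is kept as a diagonal determinant.
  module _ {b} {B : Set b} (M : Fin (suc m) → B → Carrier) (f : Vector B (suc m)) where

    -- Moving x from slot i to the front passes i columns, so the sign makes this the minor with
    -- `f i` replaced by x: entry (i, x) of adj(M_f) M.
    cofactor : Fin (suc m) → B → Carrier
    cofactor i x = signed i (det (columns M (x ∷ f ∘ punchIn i)))

    cramer : ∀ r x → sum (λ i → M r (f i) * cofactor i x) ≈ det (columns M f) * M r x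
    cramer r x = trans (sym (altSum≈sum (λ i → M r (f i)) (λ i → det (columns M (x ∷ f ∘ punchIn i)))))
                       (cramer-altSum M r x f)

    cofactor-minors : ∀ h →
      det (columns M f) * det (columns cofactor h) ≈
      det {suc m} (diag 0# (det (columns M f))) * det (columns M h)
    cofactor-minors h = begin
      det (columns M f) * det (columns cofactor h)
        ≈⟨ det-* (columns M f) (columns cofactor h) ⟨
      det (λ i j → sum (λ l → M i (f l) * cofactor l (h j)))
        ≈⟨ det-cong (λ i j → trans (cramer i (h j)) (sym (sum-diag _ (λ l → M l (h j)) i))) ⟩
      det (λ i j → sum (λ l → diag 0# (det (columns M f)) i l * M l (h j)))
        ≈⟨ det-* (diag 0# (det (columns M f))) (columns M h) ⟩
      det {suc m} (diag 0# (det (columns M f))) * det (columns M h) ∎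

-- Submodules of free modules over a PID, and division of minors.

module _ {c ℓ} (R : CommutativeRing c ℓ) where
  open CommutativeRing R hiding (zero)
  open import Algebra.Properties.Ring ring
  open import Algebra.Properties.Semiring.Sum semiring
  open import Relation.Binary.Reasoning.Setoid setoid

  record IsSubmodule {k} (S : Vector Carrier k → Set (c ⊔ ℓ)) : Set (c ⊔ ℓ) where
    field
      resp     : ∀ {u v} → (∀ i → u i ≈ v i) → S u → S v
      zero∈    : S (λ _ → 0#)
      +-closed : ∀ {u v} → S u → S v → S (λ i → u i + v i)
      *-closed : ∀ r {u} → S u → S (λ i → r * u i)

  -- The leading coordinates of members of `S` form an ideal whose generator is attained by some
  -- `v₀` in `S`; subtracting a multiple of `v₀` leads into the part of `S` with leading coordinate
  -- 0, where induction applies. A zero ideal still contributes a `v₀`, so there are exactly k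
  -- generators and H is square.
  submodule-generators : (∀ I → IsIdeal R I → IsPrincipal R I) →
    ∀ {k} {S : Vector Carrier k → Set (c ⊔ ℓ)} → IsSubmodule S →
    ∃ λ (v : Fin k → Vector Carrier k) → (∀ l → S (v l)) ×
      (∀ {w} → S w → ∃ λ (y : Vector Carrier k) → ∀ i → w i ≈ sum (λ l → v l i * y l))
  submodule-generators principal {zero} sub = [] , (λ ()) , λ _ → [] , λ ()
  submodule-generators principal {suc k} {S} sub
    with principal (λ x → ∃ λ w → S w × w zero ≈ x) record
           { resp     = λ { x≈y (w , s , p) → w , s , trans p x≈y }
           ; zero∈    = _ , zero∈ , refl
           ; +-closed = λ { (_ , s , p) (_ , t , q) → _ , +-closed s t , +-cong p q }
           ; *-closed = λ { r (_ , s , p) → _ , *-closed r s , *-congˡ p }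
           }
       | submodule-generators principal {k} {λ u → S (0# ∷ u)} record
           { resp     = λ p → resp λ { zero → refl ; (suc i) → p i }
           ; zero∈    = resp (λ { zero → refl ; (suc i) → refl }) zero∈
           ; +-closed = λ s t → resp (λ { zero → +-identityˡ 0# ; (suc i) → refl }) (+-closed s t)
           ; *-closed = λ r s → resp (λ { zero → zeroʳ r ; (suc i) → refl }) (*-closed r s)
           }
    where open IsSubmodule sub
  ... | g , g-gen | v , v∈S , v-gen with proj₂ (g-gen g) (1# , sym (*-identityˡ g))
  ... | v₀ , v₀∈S , v₀≈g = (v₀ ∷ λ l → 0# ∷ v l) , (λ { zero → v₀∈S ; (suc l) → v∈S l }) , combine
    where
    open IsSubmodule sub

    combine : ∀ {w} → S w →
      ∃ λ (y : Vector Carrier (suc k)) → ∀ i → w i ≈ v₀ i * y zero + sum (λ l → (0# ∷ v l) i * y (suc l))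
    combine {w} w∈S with proj₁ (g-gen (w zero)) (w , w∈S , refl)
    ... | r , w₀≈rg = (r ∷ proj₁ rest) , λ
      { zero → begin
          w zero            ≈⟨ w₀≈rv₀ ⟩
          r * v₀ zero       ≈⟨ *-comm _ _ ⟩
          v₀ zero * r       ≈⟨ +-identityʳ _ ⟨
          v₀ zero * r + 0#  ≈⟨ +-congˡ (trans (sum-cong-≋ {k} λ l → zeroˡ _) (sum-replicate-zero k)) ⟨
          v₀ zero * r + sum (λ l → 0# * proj₁ rest l) ∎
      ; (suc i) → begin
          w (suc i)
            ≈⟨ +-identityʳ _ ⟨
          w (suc i) + 0#
            ≈⟨ +-congˡ (trans (sym (-‿inverseˡ _)) (+-congʳ (-‿distribˡ-* r _))) ⟩
          w (suc i) + (- r * v₀ (suc i) + r * v₀ (suc i))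
            ≈⟨ +-assoc _ _ _ ⟨
          (w (suc i) + - r * v₀ (suc i)) + r * v₀ (suc i)
            ≈⟨ +-cong (proj₂ rest i) (*-comm _ _) ⟩
          sum (λ l → v l i * proj₁ rest l) + v₀ (suc i) * r
            ≈⟨ +-comm _ _ ⟩
          v₀ (suc i) * r + sum (λ l → v l i * proj₁ rest l) ∎
      }
      where
      w₀≈rv₀ : w zero ≈ r * v₀ zero
      w₀≈rv₀ = trans w₀≈rg (*-congˡ (sym v₀≈g))

      rest = v-gen (resp
        (λ { zero → trans (+-congʳ w₀≈rv₀) (trans (+-congˡ (sym (-‿distribˡ-* r _))) (-‿inverseʳ _))
           ; (suc i) → refl })
        (+-closed w∈S (*-closed (- r) v₀∈S)))

  open Determinant R

  column-span-isSubmodule : ∀ {k n} (N : Fin k → Fin n → Carrier) →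
    IsSubmodule (λ w → ∃ λ v → ∀ i → w i ≈ (N · v) i)
  column-span-isSubmodule {n = n} N = record
    { resp = λ { p (v , q) → v , λ i → trans (sym (p i)) (q i) }
    ; zero∈ = (λ _ → 0#) , λ i → sym (sum-zero {n} λ l → zeroʳ _)
    ; +-closed = λ { (u , p) (v , q) → (λ l → u l + v l) , λ i → trans (+-cong (p i) (q i))
        (sym (trans (sum-cong-≋ {n} λ l → distribˡ _ _ _) (∑-distrib-+ (λ l → N i l * u l) (λ l → N i l * v l)))) }
    ; *-closed = λ { r (u , p) → (λ l → r * u l) , λ i → trans (*-congˡ (p i))
        (trans (*-distribˡ-sum r (λ l → N i l * u l))
               (sum-cong-≋ {n} λ l → x∙yz≈y∙xz r (N i l) (u l))) }
    }
    where open import Algebra.Properties.CommutativeSemigroup *-commutativeSemigroup using (x∙yz≈y∙xz)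

  det-scale-head : ∀ {m} e {M N : Fin (suc m) → Fin (suc m) → Carrier} →
    (∀ j → M zero j ≈ e * N zero j) → (∀ i j → M (suc i) j ≈ N (suc i) j) → det M ≈ e * det N
  det-scale-head {m} e {M} {N} p q = begin
    det M                            ≈⟨ altSum-linear {suc m} e 0# {term N} {λ _ → 0#} scaled ⟩
    e * det N + 0# * altSum {suc m} (λ _ → 0#) ≈⟨ +-congˡ (zeroˡ _) ⟩
    e * det N + 0#                   ≈⟨ +-identityʳ _ ⟩
    e * det N                        ∎
    where
    term : (Fin (suc m) → Fin (suc m) → Carrier) → Vector Carrier (suc m)
    term M j = M zero j * det (λ i l → M (suc i) (punchIn j l))

    scaled : ∀ j → term M j ≈ e * term N j + 0# * 0#
    scaled j = begin
      term M j                    ≈⟨ *-cong (p j) (det-cong λ i l → q i (punchIn j l)) ⟩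
      e * N zero j * det (λ i l → N (suc i) (punchIn j l)) ≈⟨ *-assoc _ _ _ ⟩
      e * term N j                ≈⟨ +-identityʳ _ ⟨
      e * term N j + 0#           ≈⟨ +-congˡ (zeroˡ 0#) ⟨
      e * term N j + 0# * 0#      ∎

  -- The quotient `e` comes from H alone and not from `f`, so one rescaled row corrects all minors
  -- at once.
  divide-minors : IsPID R → ∀ {m n} (N : Fin (suc m) → Fin n → Carrier) x D → ¬ (D ≈ 0#) →
    (∀ f → D ∣ (x * det (columns N f))) →
    ∃ λ (X : Fin (suc m) → Fin n → Carrier) → ∀ f r →
      x * det (columns N f) ≈ D * r → det (columns X f) ≈ r
  divide-minors ((_ , integral) , principal) {m} {n} N x D D≉0 D∣ = X , minors
    where
    basis = submodule-generators principal (column-span-isSubmodule N)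

    H : Fin (suc m) → Fin (suc m) → Carrier
    H i l = proj₁ basis l i

    C : Fin (suc m) → Vector Carrier n
    C l = proj₁ (proj₁ (proj₂ basis) l)

    H≈NC : ∀ i l → H i l ≈ (N · C l) i
    H≈NC i l = proj₂ (proj₁ (proj₂ basis) l) i

    Y : Fin (suc m) → Fin n → Carrier
    Y l j = proj₁ (proj₂ (proj₂ basis) (δ j , λ i → sym (sum-δ (N i) j))) l

    N≈HY : ∀ i j → N i j ≈ sum (λ l → H i l * Y l j)
    N≈HY i j = proj₂ (proj₂ (proj₂ basis) (δ j , λ i → sym (sum-δ (N i) j))) i

    -- The columns of NC expand over all sequences of columns of `N`, increasing or not, which is
    -- why `D∣` ranges over every `f`.
    quotient : D ∣ (x * det (λ i l → (N · C l) i))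
    quotient = minors-∣ x N D∣ C

    e = proj₁ quotient

    X : Fin (suc m) → Fin n → Carrier
    X = (λ j → e * Y zero j) ∷ tail Y

    cancel : ∀ {a b} → D * a ≈ D * b → a ≈ b
    cancel {a} {b} p with integral D (a + - b)
      (trans (x[y-z]≈xy-xz D a b) (trans (+-congʳ p) (-‿inverseʳ _)))
    ... | inj₁ D≈0 = contradiction D≈0 D≉0
    ... | inj₂ q = trans (+-inverseˡ-unique _ _ q) (-‿involutive b)

    minors : ∀ f r → x * det (columns N f) ≈ D * r → det (columns X f) ≈ r
    minors f r p = cancel (begin
      D * det (columns X f)
        ≈⟨ *-congˡ (det-scale-head e {columns X f} {columns Y f} (λ j → refl) (λ i j → refl)) ⟩
      D * (e * det (columns Y f))        ≈⟨ *-assoc _ _ _ ⟨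
      (D * e) * det (columns Y f)        ≈⟨ *-congʳ (*-comm D e) ⟩
      (e * D) * det (columns Y f)        ≈⟨ *-congʳ (proj₂ quotient) ⟨
      (x * det (λ i l → (N · C l) i)) * det (columns Y f)
        ≈⟨ *-congʳ (*-congˡ (det-cong λ i l → sym (H≈NC i l))) ⟩
      (x * det H) * det (columns Y f)    ≈⟨ *-assoc _ _ _ ⟩
      x * (det H * det (columns Y f))    ≈⟨ *-congˡ (det-* H (columns Y f)) ⟨
      x * det (λ i j → sum (λ l → H i l * Y l (f j)))
        ≈⟨ *-congˡ (det-cong λ i j → sym (N≈HY i (f j))) ⟩
      x * det (columns N f)              ≈⟨ p ⟩
      D * r                              ∎)

-- The polynomial rings, evaluation and substitution.

module PolynomialRings {c ℓ} (R : CommutativeRing c ℓ) (pid : IsPID R) where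
  open CommutativeRing R hiding (zero)
  open import Algebra.Properties.Ring ring
  open import Algebra.Properties.CommutativeSemigroup *-commutativeSemigroup
    using (interchange)
  open Grassmann R (proj₁ pid)
  open import Relation.Binary.Reasoning.Setoid setoid

  polynomialRing : Set → CommutativeRing (c ⊔ ℓ) (c ⊔ ℓ)
  polynomialRing V = record
    { Carrier = Expr K V ; _≈_ = _≋_ ; _+_ = _⊕_ ; _*_ = _⊗_ ; -_ = ⊖_ ; 0# = con 0K ; 1# = con 1K
    ; isCommutativeRing = record
      { isRing = record
        { +-isAbelianGroup = record
          { isGroup = record
            { isMonoid = record
              { isSemigroup = record
                { isMagma = record
                  { isEquivalence = record { refl = ≋-refl ; sym = ≋-sym ; trans = ≋-trans }
                  ; ∙-cong = ⊕-cong }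
                ; assoc = ⊕-assoc }
              ; identity = ⊕-identityˡ , λ x → ≋-trans (⊕-comm _ _) (⊕-identityˡ x) }
            ; inverse = ⊕-inverseˡ , λ x → ≋-trans (⊕-comm _ _) (⊕-inverseˡ x)
            ; ⁻¹-cong = ⊖-cong }
          ; comm = ⊕-comm }
        ; *-cong = ⊗-cong
        ; *-assoc = ⊗-assoc
        ; *-identity = ⊗-identityˡ , λ x → ≋-trans (⊗-comm _ _) (⊗-identityˡ x)
        ; distrib = distribˡ′ , λ x y z → ≋-trans (⊗-comm _ _)
            (≋-trans (distribˡ′ x y z) (⊕-cong (⊗-comm _ _) (⊗-comm _ _))) }
      ; *-comm = ⊗-comm }
    }
    where distribˡ′ = PolyOps.distribˡ

  private
    numerator : ∀ {a b r} → a * 1# ≈ r * b → a ≈ r * b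
    numerator p = trans (sym (*-identityʳ _)) p

  module _ {V : Set} (ρ : V → K) where
    -- A value in R is tracked as the equation numerator = r times denominator, so every computation
    -- with fractions becomes one in R.
    eval-isRingRelation :
      IsRingRelation (CommutativeRing.rawRing (polynomialRing V)) rawRing (λ e r → eval ρ e ≈K ι r)
    eval-isRingRelation = record
      { +-rel = λ {x} {y} {r} {s} p q → begin
          _                          ≈⟨ *-identityʳ _ ⟩
          _ * _ + _ * _              ≈⟨ +-cong (trans (*-congʳ (numerator p)) (*-assoc _ _ _))
                                               (trans (*-congʳ (numerator q)) (trans (*-assoc _ _ _) (*-congˡ (*-comm _ _)))) ⟩
          r * _ + s * _              ≈⟨ distribʳ _ r s ⟨
          (r + s) * _                ∎
      ; *-rel = λ p q → trans (*-identityʳ _)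
                  (trans (*-cong (numerator p) (numerator q)) (interchange _ _ _ _))
      ; neg-rel = λ p → trans (*-identityʳ _) (trans (-‿cong (numerator p)) (-‿distribˡ-* _ _))
      ; 0-rel = refl
      ; 1-rel = refl
      }

  subst-isRingRelation : ∀ {V W : Set} (σ : V → Expr K W) →
    IsRingRelation (CommutativeRing.rawRing (polynomialRing V))
                   (CommutativeRing.rawRing (polynomialRing W)) (λ e p → subst σ e ≋ p)
  subst-isRingRelation σ = record
    { +-rel = ⊕-cong ; *-rel = ⊗-cong ; neg-rel = ⊖-cong ; 0-rel = ≋-refl ; 1-rel = ≋-refl }

diag-rel : ∀ {a b r} {A : Set a} {B : Set b} (_∼_ : A → B → Set r) {0A 0B x y} →
           0A ∼ 0B → x ∼ y → ∀ {m} (i j : Fin m) → diag 0A x i j ∼ diag 0B y i j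
diag-rel _∼_ p q zero    zero    = q
diag-rel _∼_ p q zero    (suc j) = p
diag-rel _∼_ p q (suc i) zero    = p
diag-rel _∼_ p q (suc i) (suc j) = diag-rel _∼_ p q i j

inject≤-increasing : ∀ {k n} (k≤n : k ≤ n) → Increasing (λ i → inject≤ i k≤n)
inject≤-increasing k≤n i j i<j
  rewrite toℕ-inject≤ i k≤n | toℕ-inject≤ j k≤n = i<j

-- From polynomial relations to the representation of ψ.

module Specialization {c ℓ} (R : CommutativeRing c ℓ) (pid : IsPID R) where
  open CommutativeRing R hiding (zero)
  open import Algebra.Properties.Ring ring
  open import Relation.Binary.Reasoning.Setoid setoid
  open Grassmann R (proj₁ pid)
  open PolynomialRings R pid
  private
    integral = proj₂ (proj₁ pid)
    module DR = Determinant R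

  det-diag≉0 : ∀ m {x} → ¬ (x ≈ 0#) → ¬ (DR.det {m} (diag 0# x) ≈ 0#)
  det-diag≉0 zero    x≉0 p = proj₁ (proj₁ pid) p
  det-diag≉0 (suc m) x≉0 p with integral _ _ (trans (sym (DR.det-diag m _)) p)
  ... | inj₁ x≈0 = x≉0 x≈0
  ... | inj₂ q   = det-diag≉0 m x≉0 q

  represents-0 : ∀ {x r} → x ≈K ι r → x ≈K 0K → r ≈ 0#
  represents-0 {(a , b) , b≉0} {r} p q with integral r b (trans (sym p) (trans q (zeroˡ b)))
  ... | inj₁ r≈0 = r≈0
  ... | inj₂ b≈0 = contradiction b≈0 b≉0

  module _ {m n} (ψ : Index (suc m) n → K) (spec : IsSpecialization (suc m) n ψ)
           (values : ∀ I → ∃ λ r → (¬ (r ≈ 0#)) × (ψ I ≈K ι r)) where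

    private
      P = polynomialRing (Fin (suc m) × Fin n)
      T = polynomialRing (Index (suc m) n)
      module P = CommutativeRing P
      module T = CommutativeRing T
      module DP = Determinant P
      module DT = Determinant T
      module S = IsRingRelation (subst-isRingRelation (genericMinor {suc m} {n}))
      module E = IsRingRelation (eval-isRingRelation ψ)

    generic : Fin (suc m) → Fin n → P.Carrier
    generic i j = var (i , j)

    value : Index (suc m) n → Carrier
    value I = proj₁ (values I)

    -- A lift of p along T → P whose specialization lies in R.
    record Lift (p : P.Carrier) : Set (c ⊔ ℓ) where
      field
        lift    : T.Carrier
        lifts   : subst genericMinor lift ≋ p
        special : Carrier
        is      : eval ψ lift ≈K ι special
    open Lift

    lift-resp : ∀ {p q} → p ≋ q → Lift q → Lift p
    lift-resp p≋q l = record
      { lift = lift l ; lifts = ≋-trans (lifts l) (≋-sym p≋q) ; special = special l ; is = is l }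

    lift-⊖ : ∀ {p} → Lift p → Lift (⊖ p)
    lift-⊖ l = record
      { lift = ⊖ lift l ; lifts = ⊖-cong (lifts l) ; special = - special l ; is = E.neg-rel {lift l} (is l) }

    lift-signed : ∀ {k} (i : Fin k) {p} → Lift p → Lift (DP.signed i p)
    lift-signed zero    l = l
    lift-signed (suc i) l = lift-⊖ (lift-signed i l)

    -- Sorting writes each minor as plus or minus a variable of T, or as 0; the lift and its special
    -- value pick up the sign together.
    lift-minor : ∀ f → Lift (DP.det (DP.columns generic f))
    lift-minor = sorting
      (record
        { resp   = λ p → lift-resp (DP.columns-cong generic p)
        ; swap   = λ s l → lift-resp (DP.det-swap generic s) (lift-⊖ l)
        ; repeat = λ s → lift-resp (DP.det-repeat generic s)
            (record { lift = con 0K ; lifts = ≋-refl ; special = 0# ; is = refl })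
        })
      λ {f} inc → record
        { lift = var (f , inc) ; lifts = ≋-refl ; special = value (f , inc)
        ; is = proj₂ (proj₂ (values (f , inc))) }

    module _ (I₀ : Index (suc m) n) where

      lift-cofactor : ∀ i j → Lift (DP.cofactor generic (proj₁ I₀) i j)
      lift-cofactor i j = lift-signed i (lift-minor (j ∷ proj₁ I₀ ∘ punchIn i))

      N : Fin (suc m) → Fin n → Carrier
      N i j = special (lift-cofactor i j)

      power : Carrier
      power = DR.det {suc m} (diag 0# (value I₀))

      -- Lifting both sides of `cofactor-minors` to T gives a difference in the kernel of p, which ψ
      -- kills. Its value is also `ι` of an element of R, so the equation descends from K to R.
      minor-relation : ∀ I → value I₀ * DR.det (DR.columns N (proj₁ I)) ≈ power * value I
      minor-relation I = trans
        (+-inverseˡ-unique _ _ (represents-0 {eval ψ relation} relation-value (spec relation relation≋0)))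
        (-‿involutive _)
        where
        n′ : Fin (suc m) → Fin (suc m) → T.Carrier
        n′ i j = lift (lift-cofactor i (proj₁ I j))

        δ₀ : Fin (suc m) → Fin (suc m) → T.Carrier
        δ₀ = diag (con 0K) (var I₀)

        relation : T.Carrier
        relation = (var I₀ ⊗ DT.det n′) ⊕ (⊖ (DT.det δ₀ ⊗ var I))

        value-var : ∀ J → eval ψ (var J) ≈K ι (value J)
        value-var J = proj₂ (proj₂ (values J))

        relation-value : eval ψ relation ≈K
          ι (value I₀ * DR.det (DR.columns N (proj₁ I)) + - (power * value I))
        relation-value = E.+-rel {var I₀ ⊗ DT.det n′} {⊖ (DT.det δ₀ ⊗ var I)}
          (E.*-rel {var I₀} {DT.det n′} (value-var I₀)
            (E.det-rel {M = n′} λ i j → is (lift-cofactor i (proj₁ I j))))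
          (E.neg-rel {DT.det δ₀ ⊗ var I} (E.*-rel {DT.det δ₀} {var I}
            (E.det-rel {M = δ₀} (diag-rel (λ e r → eval ψ e ≈K ι r) {con 0K} {x = var I₀} refl (value-var I₀)))
            (value-var I)))

        relation≋0 : subst genericMinor relation ≋ con 0K
        relation≋0 = ≋-trans
          (⊕-cong
            (⊗-cong ≋-refl (S.det-rel {M = n′} λ i j → lifts (lift-cofactor i (proj₁ I j))))
            (⊖-cong (⊗-cong
              (S.det-rel {M = δ₀} (diag-rel (λ e p → subst genericMinor e ≋ p) ≋-refl ≋-refl)) ≋-refl)))
          (≋-trans (⊕-cong (DP.cofactor-minors generic (proj₁ I₀) (proj₁ I)) ≋-refl) (P.-‿inverseʳ _))

      -- `minor-relation` reaches increasing sequences only; divisibility ignores signs and holds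
      -- for 0, so sorting extends it to all `f`.
      power-∣ : ∀ f → power DR.∣ (value I₀ * DR.det (DR.columns N f))
      power-∣ = sorting
        (record
          { resp   = λ p → DR.∣-resp (*-congˡ (DR.columns-cong N (≡.sym ∘ p)))
          ; swap   = λ { s (q , p) → - q , (begin
              _                            ≈⟨ *-congˡ (DR.det-swap N s) ⟩
              value I₀ * - _               ≈⟨ -‿distribʳ-* _ _ ⟨
              - (value I₀ * _)             ≈⟨ -‿cong p ⟩
              - (q * power)                ≈⟨ -‿distribˡ-* _ _ ⟩
              - q * power                  ∎) }
          ; repeat = λ s → 0# , trans (*-congˡ (DR.det-repeat N s)) (trans (zeroʳ _) (sym (zeroˡ _)))
          })
        λ {f} inc → value (f , inc) , trans (minor-relation (f , inc)) (*-comm _ _)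

      representation : ∃ λ (X : Fin (suc m) → Fin n → Carrier) →
        ∀ I → ι (detR (λ i j → X i (proj₁ I j))) ≈K ψ I
      representation = proj₁ divided , λ I → sym (trans (proj₂ (proj₂ (values I)))
        (*-congʳ (sym (proj₂ divided (proj₁ I) (value I) (minor-relation I)))))
        where
        divided = divide-minors R pid N (value I₀) power
                    (det-diag≉0 (suc m) (proj₁ (proj₂ (values I₀)))) power-∣

theorem3p7 : ∀ {c ℓ} (R : CommutativeRing c ℓ) (pid : IsPID R) →
    let open CommutativeRing R
        open Grassmann R (proj₁ pid)
    in ∀ (k n : ℕ) → 1 ≤ k → k ≤ n →
       (ψ : Index k n → K) → IsSpecialization k n ψ →
       (∀ I → ∃ λ r → (¬ (r ≈ 0#)) × (ψ I ≈K ι r)) →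
       ∃ λ (X : Fin k → Fin n → Carrier) →
         ∀ I → ι (detR (λ i j → X i (proj₁ I j))) ≈K ψ I
theorem3p7 R pid (suc m) n 1≤k k≤n ψ spec values =
  Specialization.representation R pid ψ spec values
    ((λ i → inject≤ i k≤n) , inject≤-increasing k≤n)
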